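{- Let $G$ be a graph with vertex set $V=\{v_1,\ldots,v_n\}$ and singular Seidel matrix $S$, and let $\phi=\phi(S)=(\phi_1,\dots,\phi_n)$. Then for all $1\le i,j\le n$ the following hold: (i) $\phi_i-\phi_j\equiv 2(d(v_i)-d(v_j)) \pmod 4$; (ii) if $G$ is an even graph, then $\phi_i-\phi_j\equiv 2(d(v_i)-d(v_j)) \pmod 8$.
   Context: All graphs are simple, undirected, finite, with at least one vertex. $d(v)$ denotes the degree of a vertex $v$ in $G$; a graph is called even if every vertex has even degree. For a graph $G$ with vertices $v_1,\dots,v_n$ and adjacency matrix $A$, the Seidel matrix of $G$ is $S=J_n-I_n-2A$, where $J_n$ is the all-ones $n\times n$ matrix and $I_n$ the identity. It is known that $\operatorname{rank} S\ge n-1$ always. Hence, when $S$ is singular, its nullspace is one-dimensional, and $\phi=\phi(G)=\phi(S)$ denotes the unique integer vector $\phi\in\mathbb{Z}^n$ with $S\phi=0$, with the greatest common divisor of its entries equal to $1$, and with first non-zero entry positive. -}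

module Defs where

open import Data.Bool.Base using (Bool; false; if_then_else_)
open import Data.Fin.Base using (Fin; zero; suc; toℕ; _<_)
open import Data.Fin.Properties using (_≟_)
open import Data.Fin.Subset using (Subset) renaming (∣_∣ to card)
open import Data.Integer.Base as ℤ using (ℤ; +_; 0ℤ; 1ℤ; -1ℤ; _+_; _-_; _*_; _^_)
open import Data.Integer.Divisibility.Signed using (_∣_)
open import Data.Integer.GCD using (gcd)
open import Data.Integer.Properties using (+-*-semiring)
open import Data.Nat.Base as ℕ using (ℕ)
import Data.Nat.Divisibility as ℕ
open import Data.Product.Base using (_×_; ∃-syntax)
open import Data.Vec.Base using (tabulate)
open import Data.Vec.Functional using (Vector; foldr; removeAt)
open import Relation.Binary.PropositionalEquality.Core using (_≡_)
open import Relation.Nullary.Decidable.Core using (does)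

open import Algebra.Properties.Semiring.Sum +-*-semiring using (sum)

private variable
  m n : ℕ

record Graph (n : ℕ) : Set where
  field
    adj    : Fin n → Fin n → Bool
    symm   : ∀ u v → adj u v ≡ adj v u
    irrefl : ∀ v → adj v v ≡ false

  neighbours : Fin n → Subset n
  neighbours v = tabulate (adj v)

  degree : Fin n → ℕ
  degree v = card (neighbours v)

  Even : Set
  Even = ∀ v → 2 ℕ.∣ degree v

open Graph public

Matrix : ℕ → ℕ → Set
Matrix m n = Fin m → Fin n → ℤ

_·_ : Matrix m n → Vector ℤ n → Vector ℤ m
(M · x) i = sum λ j → M i j * x j

-- Laplace expansion along the first row.
det : Matrix n n → ℤ
det {ℕ.zero}  M = 1ℤ
det {ℕ.suc n} M = sum λ j →
  -1ℤ ^ toℕ j * M zero j * det (λ i → removeAt (M (suc i)) j)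

Singular : Matrix n n → Set
Singular M = det M ≡ 0ℤ

allOnes : Matrix n n
allOnes i j = 1ℤ

identity : Matrix n n
identity i j = if does (i ≟ j) then 1ℤ else 0ℤ

adjacency : Graph n → Matrix n n
adjacency G i j = if adj G i j then 1ℤ else 0ℤ

seidel : Graph n → Matrix n n
seidel G i j = allOnes i j - identity i j - + 2 * adjacency G i j

gcdEntries : Vector ℤ n → ℤ
gcdEntries = foldr gcd 0ℤ

FirstNonzeroPositive : Vector ℤ n → Set
FirstNonzeroPositive x = ∃[ i ] (∀ j → j < i → x j ≡ 0ℤ) × 0ℤ ℤ.< x i

-- `IsPhi S φ` says that φ is the normalised generator φ(S) of the nullspace.
-- Such a φ is unique when the nullspace of S is one-dimensional, as it is for
-- every singular Seidel matrix.
record IsPhi (S : Matrix n n) (φ : Vector ℤ n) : Set where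
  field
    null      : ∀ i → (S · φ) i ≡ 0ℤ
    coprime   : gcdEntries φ ≡ 1ℤ
    positive  : FirstNonzeroPositive φ

infix 4 _≡_[mod_]

_≡_[mod_] : ℤ → ℤ → ℤ → Set
a ≡ b [mod k ] = k ∣ (a - b)

{-# OPTIONS --safe #-}
-- Row i of Sφ = 0 reads φᵢ = Σφ − 2(Aφ)ᵢ, hence φᵢ − φⱼ = −2((Aφ)ᵢ − (Aφ)ⱼ).
-- In particular all entries have the same parity, and since their gcd is 1 they
-- are all odd.  If every entry of φ is ≡ a (mod m), then (Aφ)ᵢ ≡ a d(vᵢ) (mod m)
-- and so φᵢ − φⱼ ≡ −2a(d(vᵢ) − d(vⱼ)) (mod 2m).  Taking m = 2, a = −1 gives (i).
-- If G is even, (i) shows that all entries agree mod 4, so m = 4, a = φᵢ is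
-- admissible, and −2a may be replaced by 2 because 2(a + 1)(d(vᵢ) − d(vⱼ)) is
-- divisible by 2 · 2 · 2.
module Submission where

open import Defs
open import Data.Bool.Base using (Bool; true; false; if_then_else_)
open import Data.Fin.Base using (Fin; zero; suc)
open import Data.Fin.Subset using () renaming (∣_∣ to card)
open import Data.Integer.Base using (ℤ; +_; -1ℤ; 0ℤ; 1ℤ; _+_; _-_; _*_)
open import Data.Integer.DivMod using (_/_; _%_; n%d<d; a≡a%n+[a/n]*n)
open import Data.Integer.Divisibility.Signed
open import Data.Integer.GCD using (gcd-greatest)
open import Data.Integer.Properties using (+-*-semiring; +-identityˡ)
open import Algebra.Properties.Semiring.Sum +-*-semiring using (sum)
open import Data.Integer.Tactic.RingSolver using (solve-∀)
open import Data.Nat.Base as ℕ using (ℕ; _≥_; s≤s)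
open import Data.Product.Base using (_×_; _,_)
open import Data.Sum.Base using (_⊎_; inj₁; inj₂)
open import Data.Vec.Base using (tabulate)
open import Data.Vec.Functional using (Vector)
open import Function.Base using (_∘_)
open import Relation.Binary.PropositionalEquality
open import Relation.Nullary.Decidable using (from-no)
open import Relation.Nullary.Negation using (contradiction)

private variable
  n : ℕ

∣-gcdEntries : ∀ {c} (x : Vector ℤ n) → (∀ i → c ∣ x i) → c ∣ gcdEntries x
∣-gcdEntries {ℕ.zero}  x c∣x = divides 0ℤ refl
∣-gcdEntries {ℕ.suc n} {c} x c∣x = ∣ᵤ⇒∣
  (gcd-greatest {x zero} {gcdEntries (x ∘ suc)} {c}
    (∣⇒∣ᵤ (c∣x zero)) (∣⇒∣ᵤ (∣-gcdEntries (x ∘ suc) (c∣x ∘ suc))))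

-- Oddness is phrased as `x` being congruent to `-1ℤ`, since `-1ℤ` is the common residue chosen
-- later modulo 2.
even⊎odd : ∀ x → (+ 2 ∣ x) ⊎ (+ 2 ∣ x - -1ℤ)
even⊎odd x with x % + 2 | n%d<d x (+ 2) | a≡a%n+[a/n]*n x (+ 2)
... | 0 | _ | eq = inj₁ (divides (x / + 2) (trans eq (lemma (x / + 2))))
  where
  lemma : ∀ q → + 0 + q * + 2 ≡ q * + 2
  lemma = solve-∀
... | 1 | _ | eq = inj₂ (divides (x / + 2 + 1ℤ) (trans (cong (_- -1ℤ) eq) (lemma (x / + 2))))
  where
  lemma : ∀ q → + 1 + q * + 2 - -1ℤ ≡ (q + 1ℤ) * + 2
  lemma = solve-∀
... | ℕ.suc (ℕ.suc _) | s≤s (s≤s ()) | _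

sum-zero-* : ∀ (x : Vector ℤ n) → sum (λ j → 0ℤ * x j) ≡ 0ℤ
sum-zero-* {ℕ.zero}  x = refl
sum-zero-* {ℕ.suc n} x = trans (+-identityˡ _) (sum-zero-* (x ∘ suc))

identity-· : ∀ (x : Vector ℤ n) i → (identity · x) i ≡ x i
identity-· x zero = trans (cong (λ s → 1ℤ * x zero + s) (sum-zero-* (x ∘ suc))) (lemma (x zero))
  where
  lemma : ∀ a → 1ℤ * a + 0ℤ ≡ a
  lemma = solve-∀
identity-· x (suc i) = trans (+-identityˡ _) (identity-· (x ∘ suc) i)

-- `δ` and `α` stand for a row of the identity and of the adjacency matrix. They are arbitrary
-- vectors because the induction passes to tails, which need not be such rows again.
sum-seidelRow : ∀ (δ α x : Vector ℤ n) →
  sum (λ j → (1ℤ - δ j - + 2 * α j) * x j)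
    ≡ sum x - sum (λ j → δ j * x j) - + 2 * sum (λ j → α j * x j)
sum-seidelRow {ℕ.zero}  δ α x = refl
sum-seidelRow {ℕ.suc n} δ α x = trans
  (cong (λ s → (1ℤ - δ zero - + 2 * α zero) * x zero + s)
    (sum-seidelRow (δ ∘ suc) (α ∘ suc) (x ∘ suc)))
  (lemma (δ zero) (α zero) (x zero) _ _ _)
  where
  lemma : ∀ d a y s t u →
    (1ℤ - d - + 2 * a) * y + (s - t - + 2 * u)
      ≡ (y + s) - (d * y + t) - + 2 * (a * y + u)
  lemma = solve-∀

seidel-· : ∀ (G : Graph n) x i →
  (seidel G · x) i ≡ sum x - x i - + 2 * (adjacency G · x) i
seidel-· G x i = trans (sum-seidelRow (identity i) (adjacency G i) x)
  (cong (λ t → sum x - t - + 2 * (adjacency G · x) i) (identity-· x i))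

-- For `b = adj G k` this is definitionally `(adjacency G · x) k`, and `card (tabulate b)` is the
-- degree of `k`.
sum-select : (Fin n → Bool) → Vector ℤ n → ℤ
sum-select b x = sum λ j → (if b j then 1ℤ else 0ℤ) * x j

sum-select-mod : ∀ {m a} (b : Fin n → Bool) (x : Vector ℤ n) → (∀ k → m ∣ x k - a) →
  m ∣ sum-select b x - a * + card (tabulate b)
sum-select-mod {ℕ.zero}  {m} {a} b x m∣ = divides 0ℤ (lemma a m)
  where
  lemma : ∀ a m → 0ℤ - a * 0ℤ ≡ 0ℤ * m
  lemma = solve-∀
sum-select-mod {ℕ.suc n} {m} {a} b x m∣
  with b zero | sum-select-mod {a = a} (b ∘ suc) (x ∘ suc) (m∣ ∘ suc)
... | true  | ih = subst (m ∣_) (lemma a (x zero) _ _) (∣m∣n⇒∣m+n (m∣ zero) ih)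
  where
  lemma : ∀ a y s c → y - a + (s - a * c) ≡ 1ℤ * y + s - a * (1ℤ + c)
  lemma = solve-∀
... | false | ih = subst (λ s → m ∣ s - a * + card (tabulate (b ∘ suc)))
  (sym (+-identityˡ (sum-select (b ∘ suc) (x ∘ suc)))) ih

module _ (G : Graph n) {φ : Vector ℤ n} (null : ∀ i → (seidel G · φ) i ≡ 0ℤ) where

  private
    Aφ : Vector ℤ n
    Aφ = adjacency G · φ

  -- Subtracting row `i` of the null equation from row `j` cancels the total `sum φ`.
  difference : ∀ i j → φ i - φ j ≡ + 2 * (Aφ j - Aφ i)
  difference i j = trans (lemma (sum φ) (φ i) (φ j) (Aφ i) (Aφ j))
    (trans (cong₂ (λ s t → s - t + + 2 * (Aφ j - Aφ i)) (row j) (row i)) (zeros _))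
    where
    row : ∀ k → sum φ - φ k - + 2 * Aφ k ≡ 0ℤ
    row k = trans (sym (seidel-· G φ k)) (null k)
    lemma : ∀ s a b u v →
      a - b ≡ (s - b - + 2 * v) - (s - a - + 2 * u) + + 2 * (v - u)
    lemma = solve-∀
    zeros : ∀ y → 0ℤ - 0ℤ + y ≡ y
    zeros = solve-∀

  difference-even : ∀ i j → + 2 ∣ φ i - φ j
  difference-even i j =
    subst (+ 2 ∣_) (sym (difference i j)) (∣m⇒∣m*n _ ∣-refl)

  odd-entries : gcdEntries φ ≡ 1ℤ → ∀ i → + 2 ∣ φ i - -1ℤ
  odd-entries coprime i with even⊎odd (φ i)
  ... | inj₂ odd  = odd
  -- One even entry makes every entry even, as all differences are even; then 2 would divide the gcd
  -- 1.
  ... | inj₁ even = contradiction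
    (subst (+ 2 ∣_) coprime (∣-gcdEntries φ all-even)) (from-no (+ 2 ∣? 1ℤ))
    where
    lemma : ∀ a b → a - b + b ≡ a
    lemma = solve-∀
    all-even : ∀ k → + 2 ∣ φ k
    all-even k = subst (+ 2 ∣_) (lemma (φ k) (φ i)) (∣m∣n⇒∣m+n (difference-even k i) even)

  -- Modulo `m`, `Aφ j - Aφ i` is `a` times the degree difference `dⱼ - dᵢ`. This differs from the
  -- wanted `dᵢ - dⱼ` by a multiple of `(a + 1ℤ) * (dᵢ - dⱼ)`, which the last hypothesis removes.
  -- The factor 2 in `difference` doubles the modulus.
  difference-mod : ∀ {m} a → (∀ k → m ∣ φ k - a) → ∀ i j →
    m ∣ (a + 1ℤ) * (+ degree G i - + degree G j) →
    φ i - φ j ≡ + 2 * (+ degree G i - + degree G j) [mod + 2 * m ]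
  difference-mod {m} a φ≡a i j m∣ = subst (+ 2 * m ∣_)
    (trans (lemma a (Aφ i) (Aφ j) dᵢ dⱼ)
      (cong (_- + 2 * (dᵢ - dⱼ)) (sym (difference i j))))
    (*-monoʳ-∣ (+ 2) (∣m∣n⇒∣m-n (∣m∣n⇒∣m-n (Aφ-mod j) (Aφ-mod i)) m∣))
    where
    dᵢ = + degree G i
    dⱼ = + degree G j
    Aφ-mod : ∀ k → m ∣ Aφ k - a * + degree G k
    Aφ-mod k = sum-select-mod (adj G k) φ φ≡a
    lemma : ∀ a u v c d →
      + 2 * ((v - a * d) - (u - a * c) - (a + 1ℤ) * (c - d))
        ≡ + 2 * (v - u) - + 2 * (c - d)
    lemma = solve-∀

  difference-mod-4 : gcdEntries φ ≡ 1ℤ → ∀ i j →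
    φ i - φ j ≡ + 2 * (+ degree G i - + degree G j) [mod + 4 ]
  difference-mod-4 coprime i j =
    difference-mod -1ℤ (odd-entries coprime) i j
      -- With `a = -1ℤ` the factor `a + 1ℤ` is 0, whence the quotient `0ℤ`.
      (∣m⇒∣m*n (+ degree G i - + degree G j) (divides {+ 2} 0ℤ refl))

  difference-mod-8 : gcdEntries φ ≡ 1ℤ → Even G → ∀ i j →
    φ i - φ j ≡ + 2 * (+ degree G i - + degree G j) [mod + 8 ]
  difference-mod-8 coprime even i j =
    difference-mod (φ i) (λ k → 4∣difference k i) i j
      -- The divisor 4 splits as 2 from the degree difference times 2 from `φ i + 1ℤ`, which is even
      -- because `φ i` is odd.
      (∣-trans (*-monoʳ-∣ (+ 2) (degrees-even i j))
               (*-monoˡ-∣ _ (odd-entries coprime i)))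
    where
    degrees-even : ∀ k l → + 2 ∣ + degree G k - + degree G l
    degrees-even k l = ∣m∣n⇒∣m-n (∣ᵤ⇒∣ {i = + degree G k} (even k)) (∣ᵤ⇒∣ {i = + degree G l} (even l))
    lemma : ∀ x y → x - y + y ≡ x
    lemma = solve-∀
    -- Even degrees make the right-hand side of the congruence modulo 4 vanish, so it can be added
    -- back.
    4∣difference : ∀ k l → + 4 ∣ φ k - φ l
    4∣difference k l = subst (+ 4 ∣_)
      (lemma (φ k - φ l) (+ 2 * (+ degree G k - + degree G l)))
      (∣m∣n⇒∣m+n (difference-mod-4 coprime k l)
                  (*-monoʳ-∣ (+ 2) (degrees-even k l)))

theorem3p2 : (n : ℕ) → n ≥ 1 →
    (G : Graph n) → Singular (seidel G) →
    (φ : Vector ℤ n) → IsPhi (seidel G) φ →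
    (i j : Fin n) →
    (φ i - φ j ≡ + 2 * (+ degree G i - + degree G j) [mod + 4 ])
    × (Even G → φ i - φ j ≡ + 2 * (+ degree G i - + degree G j) [mod + 8 ])
theorem3p2 n _ G _ φ isPhi i j =
  difference-mod-4 G null coprime i j , λ even → difference-mod-8 G null coprime even i j
  where open IsPhi isPhi
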